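{- Let $\varphi_3:\mathbb{N}\to\mathbb{N}$ be the function defined as follows. The values $\varphi_3(0),\varphi_3(1),\dots,\varphi_3(29)$ are, in order, $$3,1,4,0,2,7,6,5,9,8,\ 11,10,13,12,19,18,21,20,15,14,\ 17,16,27,26,29,28,23,22,25,24.$$ (1) If either $30\le x<56$ or $7\cdot 2^{2n}\le x<7\cdot 2^{2n+1}$ for some integer $n\ge 2$, then $\varphi_3(x)=x\oplus 1$. (2) If $7\cdot 2^{2n-1}\le x<7\cdot 2^{2n}$ for some integer $n\ge2$, then $\varphi_3(x)=x\oplus 3$. Then, for all nonnegative integers $a,b$, the Halve Nim position $a^1b^13^1$ is a $\mathcal{P}$-position if and only if $b=\varphi_3(a)$. Furthermore, for $a,b\ge 30$, $a^1b^13^1$ is a $\mathcal{P}$-position if and only if $$a\oplus b=2+(-1)^{\lfloor\log_2(a/7)\rfloor+1}.$$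
   Context: $\mathbb{N}$ is the set of nonnegative integers and $\oplus$ denotes bitwise XOR. Halve Nim is a two-player game played on finitely many piles of coins; players alternate moves and a player who cannot move loses. A move is one of: (i) choose one pile and remove at least one coin from it; (ii) halve the game: simultaneously replace every pile of $m$ coins by a pile of $\lfloor m/2\rfloor$ coins. When there are no coins left, no move is available (halving requires at least one coin to be present). A position is a $\mathcal{P}$-position if the player who is not about to move has a winning strategy (equivalently, every move from it leads to an $\mathcal{N}$-position), and an $\mathcal{N}$-position if the player about to move has a winning strategy. $a^1b^1c^1$ denotes the position with three piles of sizes $a$, $b$, $c$ (a pile of size $0$ is an empty pile); in particular $a^1b^13^1$ has piles of sizes $a$, $b$, $3$. -}

module Defs where

open import Data.Integer.Base as ℤ using (ℤ; +_)
import Data.Integer.Properties as ℤ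
open import Data.Fin.Base using (fromℕ<)
open import Data.List.Base using (List; []; _∷_; _++_; map; upTo)
open import Data.List.Relation.Unary.Any using (Any)
open import Data.Nat
open import Data.Nat.DivMod
open import Data.Nat.Induction using (<-rec)
open import Data.Nat.Logarithm
open import Data.Nat.Properties
open import Data.Product using (∃-syntax; _×_; _,_; proj₁; proj₂)
open import Data.Rational.Unnormalised.Base as ℚ using (ℚᵘ; mkℚᵘ)
open import Data.Sum using (_⊎_; inj₁; inj₂)
open import Data.Vec.Base as Vec using (Vec; []; _∷_)
open import Relation.Binary.PropositionalEquality
open import Relation.Nullary using (yes; no; contradiction)

------------------------------------------------------------------------
-- Bitwise XOR

-- The first argument bounds the number of binary digits processed.
xorDigits : ℕ → ℕ → ℕ → ℕ
xorDigits zero    m n = 0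
xorDigits (suc k) m n =
  (m % 2 + n % 2) % 2 + 2 * xorDigits k ⌊ m /2⌋ ⌊ n /2⌋

infixl 6 _⊕_

_⊕_ : ℕ → ℕ → ℕ
m ⊕ n = xorDigits (m + n) m n

private
  xorDigits-0 : ∀ k → xorDigits k 0 0 ≡ 0
  xorDigits-0 zero    = refl
  xorDigits-0 (suc k) = cong (2 *_) (xorDigits-0 k)

  half-≤ : ∀ {m k} → m ≤ suc k → ⌊ m /2⌋ ≤ k
  half-≤ {zero}  _ = z≤n
  half-≤ {suc m} p = s≤s⁻¹ (≤-trans (⌊n/2⌋<n m) p)

  xorDigits-stable : ∀ k l {m n} → m ≤ k → n ≤ k → m ≤ l → n ≤ l →
                     xorDigits k m n ≡ xorDigits l m n
  xorDigits-stable zero    l       z≤n z≤n _ _ = sym (xorDigits-0 l)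
  xorDigits-stable (suc k) zero    _ _ z≤n z≤n = xorDigits-0 (suc k)
  xorDigits-stable (suc k) (suc l) {m} {n} p q r s =
    cong (λ z → (m % 2 + n % 2) % 2 + 2 * z)
      (xorDigits-stable k l (half-≤ p) (half-≤ q) (half-≤ r) (half-≤ s))

-- m + n digits are always enough.
⊕-step : ∀ m n → m ⊕ n ≡ (m % 2 + n % 2) % 2 + 2 * (⌊ m /2⌋ ⊕ ⌊ n /2⌋)
⊕-step m n = trans
  (xorDigits-stable (m + n) (suc (m + n))
    (m≤m+n m n) (m≤n+m n m) (m≤n⇒m≤1+n (m≤m+n m n)) (m≤n⇒m≤1+n (m≤n+m n m)))
  (cong (λ z → (m % 2 + n % 2) % 2 + 2 * z)
    (xorDigits-stable (m + n) (⌊ m /2⌋ + ⌊ n /2⌋)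
      (≤-trans (⌊n/2⌋≤n m) (m≤m+n m n))
      (≤-trans (⌊n/2⌋≤n n) (m≤n+m n m))
      (m≤m+n _ _) (m≤n+m _ ⌊ m /2⌋)))

------------------------------------------------------------------------
-- Halve Nim

Position : Set
Position = List ℕ

infix 4 _⟶_

data _⟶_ : Position → Position → Set where
  remove : ∀ ps {m k} qs → k < m → (ps ++ m ∷ qs) ⟶ (ps ++ k ∷ qs)
  halve  : ∀ {ps} → Any (0 <_) ps → ps ⟶ map ⌊_/2⌋ ps

-- Inductive, so a proof is a winning strategy: a well-founded tree with
-- one chosen move at each turn of the winner and all moves of the loser.
mutual
  data 𝒫-position (p : Position) : Set where
    𝒫 : (∀ q → p ⟶ q → 𝒩-position q) → 𝒫-position p

  data 𝒩-position (p : Position) : Set where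
    𝒩 : ∀ q → p ⟶ q → 𝒫-position q → 𝒩-position p

------------------------------------------------------------------------
-- Integer part of the binary logarithm of a rational

-- Meaningful only for q ≥ 1, where replacing q by its integer part does not
-- change the result; ⌊log₂ᵘ⌋-spec is the defining property of ⌊log₂ q⌋.
⌊log₂ᵘ_⌋ : ℚᵘ → ℕ
⌊log₂ᵘ q ⌋ = ⌊log₂ ℤ.∣ ℚ.floor q ∣ ⌋

2^⌊log₂n⌋≤n : ∀ n .{{_ : NonZero n}} → 2 ^ ⌊log₂ n ⌋ ≤ n
2^⌊log₂n⌋≤n n = <-rec (λ n → 1 ≤ n → 2 ^ ⌊log₂ n ⌋ ≤ n) go n (>-nonZero⁻¹ n)
  where
  open ≤-Reasoning

  double-half : ∀ n → 2 * ⌊ n /2⌋ ≤ n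
  double-half zero          = z≤n
  double-half (suc zero)    = z≤n
  double-half (suc (suc n)) = begin
    2 * suc ⌊ n /2⌋ ≡⟨ *-suc 2 ⌊ n /2⌋ ⟩
    2 + 2 * ⌊ n /2⌋ ≤⟨ +-monoʳ-≤ 2 (double-half n) ⟩
    2 + n           ∎

  go : ∀ n → (∀ {m} → m < n → 1 ≤ m → 2 ^ ⌊log₂ m ⌋ ≤ m) →
       1 ≤ n → 2 ^ ⌊log₂ n ⌋ ≤ n
  go (suc zero)        rec _ = s≤s z≤n
  go m@(suc (suc n′)) rec _ = begin
    2 ^ ⌊log₂ m ⌋             ≡⟨ cong (2 ^_) (m∸n+n≡m 1≤log) ⟨
    2 ^ (⌊log₂ m ⌋ ∸ 1 + 1)   ≡⟨ cong (2 ^_) (+-comm (⌊log₂ m ⌋ ∸ 1) 1) ⟩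
    2 * 2 ^ (⌊log₂ m ⌋ ∸ 1)   ≡⟨ cong (λ z → 2 * 2 ^ z) (⌊log₂⌊n/2⌋⌋≡⌊log₂n⌋∸1 m) ⟨
    2 * 2 ^ ⌊log₂ ⌊ m /2⌋ ⌋   ≤⟨ *-monoʳ-≤ 2 (rec (⌊n/2⌋<n (suc n′)) (s≤s z≤n)) ⟩
    2 * ⌊ m /2⌋               ≤⟨ double-half m ⟩
    m                         ∎
    where
    1≤log : 1 ≤ ⌊log₂ m ⌋
    1≤log = ⌊log₂⌋-mono-≤ {2} {m} (s≤s (s≤s z≤n))

n<2^[1+⌊log₂n⌋] : ∀ n → n < 2 ^ (⌊log₂ n ⌋ + 1)
n<2^[1+⌊log₂n⌋] n = ≰⇒> λ p → 1+n≰n (begin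
  suc ⌊log₂ n ⌋                 ≡⟨ +-comm 1 ⌊log₂ n ⌋ ⟩
  ⌊log₂ n ⌋ + 1                 ≡⟨ ⌊log₂[2^n]⌋≡n (⌊log₂ n ⌋ + 1) ⟨
  ⌊log₂ 2 ^ (⌊log₂ n ⌋ + 1) ⌋ ≤⟨ ⌊log₂⌋-mono-≤ p ⟩
  ⌊log₂ n ⌋                     ∎)
  where open ≤-Reasoning

⌊log₂ᵘ⌋-spec : ∀ q → ℚ.1ℚᵘ ℚ.≤ q →
  (+ (2 ^ ⌊log₂ᵘ q ⌋) ℚ./ 1) ℚ.≤ q × q ℚ.< (+ (2 ^ (⌊log₂ᵘ q ⌋ + 1)) ℚ./ 1)
⌊log₂ᵘ⌋-spec q@(mkℚᵘ (ℤ.-[1+ _ ]) d) (ℚ.*≤* ())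
⌊log₂ᵘ⌋-spec q@(mkℚᵘ (+ n) d) (ℚ.*≤* p) =
  ℚ.*≤* (subst₂ ℤ._≤_ (ℤ.pos-* (2 ^ k) (suc d)) (sym (ℤ.*-identityʳ (+ n)))
    (ℤ.+≤+ lower)) ,
  ℚ.*<* (subst₂ ℤ._<_ (sym (ℤ.*-identityʳ (+ n))) (ℤ.pos-* (2 ^ (k + 1)) (suc d))
    (ℤ.+<+ upper))
  where
  open ≤-Reasoning

  k = ⌊log₂ᵘ q ⌋

  floor≡ : ℤ.∣ ℚ.floor q ∣ ≡ n / suc d
  floor≡ = cong ℤ.∣_∣ (ℤ.*-identityˡ (+ (n / suc d)))

  k≡ : k ≡ ⌊log₂ n / suc d ⌋
  k≡ = cong ⌊log₂_⌋ floor≡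

  d<n : suc d ≤ n
  d<n = ℤ.drop‿+≤+ (subst₂ ℤ._≤_ (ℤ.*-identityˡ (+ suc d)) (ℤ.*-identityʳ (+ n)) p)

  lower : 2 ^ k * suc d ≤ n
  lower = begin
    2 ^ k * suc d                   ≡⟨ cong (λ z → 2 ^ z * suc d) k≡ ⟩
    2 ^ ⌊log₂ n / suc d ⌋ * suc d   ≤⟨ *-monoˡ-≤ (suc d) (2^⌊log₂n⌋≤n (n / suc d) {{≢-nonZero λ e → <⇒≢ (m≥n⇒m/n>0 d<n) (sym e)}}) ⟩
    n / suc d * suc d               ≤⟨ m/n*n≤m n (suc d) ⟩
    n                               ∎

  upper : n < 2 ^ (k + 1) * suc d
  upper = begin-strict
    n                                     ≡⟨ m≡m%n+[m/n]*n n (suc d) ⟩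
    n % suc d + n / suc d * suc d         <⟨ +-monoˡ-< (n / suc d * suc d) (m%n<n n (suc d)) ⟩
    suc (n / suc d) * suc d               ≤⟨ *-monoˡ-≤ (suc d) (n<2^[1+⌊log₂n⌋] (n / suc d)) ⟩
    2 ^ (⌊log₂ n / suc d ⌋ + 1) * suc d   ≡⟨ cong (λ z → 2 ^ (z + 1) * suc d) k≡ ⟨
    2 ^ (k + 1) * suc d                   ∎

------------------------------------------------------------------------
-- The function φ₃

record IsΦ₃ (φ : ℕ → ℕ) : Set where
  field
    below-30 : map φ (upTo 30) ≡
      3 ∷ 1 ∷ 4 ∷ 0 ∷ 2 ∷ 7 ∷ 6 ∷ 5 ∷ 9 ∷ 8 ∷
      11 ∷ 10 ∷ 13 ∷ 12 ∷ 19 ∷ 18 ∷ 21 ∷ 20 ∷ 15 ∷ 14 ∷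
      17 ∷ 16 ∷ 27 ∷ 26 ∷ 29 ∷ 28 ∷ 23 ∷ 22 ∷ 25 ∷ 24 ∷ []
    xor-1 : ∀ x →
      (30 ≤ x × x < 56) ⊎
      (∃[ n ] 2 ≤ n × 7 * 2 ^ (2 * n) ≤ x × x < 7 * 2 ^ (2 * n + 1)) →
      φ x ≡ x ⊕ 1
    xor-3 : ∀ x →
      (∃[ n ] 2 ≤ n × 7 * 2 ^ (2 * n ∸ 1) ≤ x × x < 7 * 2 ^ (2 * n)) →
      φ x ≡ x ⊕ 3

-- The clauses of IsΦ₃ are consistent.

private
  by-parity : ℕ → ℕ → ℕ
  by-parity zero    x = x ⊕ 1
  by-parity (suc _) x = x ⊕ 3

φ₃ : ℕ → ℕ
φ₃ x with x <? 30
... | yes x<30 = Vec.lookup table (fromℕ< x<30)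
  where
  table : Vec ℕ 30
  table =
    3 ∷ 1 ∷ 4 ∷ 0 ∷ 2 ∷ 7 ∷ 6 ∷ 5 ∷ 9 ∷ 8 ∷
    11 ∷ 10 ∷ 13 ∷ 12 ∷ 19 ∷ 18 ∷ 21 ∷ 20 ∷ 15 ∷ 14 ∷
    17 ∷ 16 ∷ 27 ∷ 26 ∷ 29 ∷ 28 ∷ 23 ∷ 22 ∷ 25 ∷ 24 ∷ []
... | no _ = by-parity (⌊log₂ x / 7 ⌋ % 2) x

φ₃-isΦ₃ : IsΦ₃ φ₃
φ₃-isΦ₃ = record
  { below-30 = refl
  ; xor-1 = λ where
      x (inj₁ (30≤x , x<56)) → φ₃-large x 30≤x
        (cong (_% 2) (log-unique 2 (≤-trans (m≤n+m 28 2) 30≤x) x<56))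
      x (inj₂ (n , 2≤n , lo , hi)) → φ₃-large x
        (large (2 * n) (≤-trans (n≤1+n 3) (*-monoʳ-≤ 2 2≤n)) lo)
        (trans (cong (_% 2) (log-unique (2 * n) lo hi)) (even n))
  ; xor-3 = λ where
      x (suc n , s≤s 1≤n , lo , hi) →
        let e : 2 * suc n ≡ (2 * n + 1) + 1
            e = trans (*-suc 2 n) (trans (+-comm 2 (2 * n)) (sym (+-assoc (2 * n) 1 1)))
            e′ : 2 * suc n ∸ 1 ≡ 2 * n + 1
            e′ = trans (cong (_∸ 1) e) (m+n∸n≡m (2 * n + 1) 1)
            lo′ = subst (λ z → 7 * 2 ^ z ≤ x) e′ lo
            hi′ = subst (λ z → x < 7 * 2 ^ z) e hi
        in φ₃-large x
          (large (2 * n + 1) (+-monoˡ-≤ 1 (*-monoʳ-≤ 2 1≤n)) lo′)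
          (trans (cong (_% 2) (log-unique (2 * n + 1) lo′ hi′)) (odd n))
  }
  where
  open ≤-Reasoning

  φ₃-large : ∀ x {r} → 30 ≤ x → ⌊log₂ x / 7 ⌋ % 2 ≡ r → φ₃ x ≡ by-parity r x
  φ₃-large x 30≤x e with x <? 30
  ... | yes x<30 = contradiction 30≤x (<⇒≱ x<30)
  ... | no _     = cong (λ r → by-parity r x) e

  even : ∀ n → (2 * n) % 2 ≡ 0
  even n = trans (cong (_% 2) (*-comm 2 n)) (m*n%n≡0 n 2)

  odd : ∀ n → (2 * n + 1) % 2 ≡ 1
  odd n = trans (cong (_% 2) (trans (+-comm (2 * n) 1) (cong suc (*-comm 2 n))))
                ([m+kn]%n≡m%n 1 n 2)

  large : ∀ k {x} → 3 ≤ k → 7 * 2 ^ k ≤ x → 30 ≤ x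
  large k {x} 3≤k lo = begin
    30        ≤⟨ m≤n+m 30 26 ⟩
    7 * 2 ^ 3 ≤⟨ *-monoʳ-≤ 7 (^-monoʳ-≤ 2 3≤k) ⟩
    7 * 2 ^ k ≤⟨ lo ⟩
    x         ∎

  log-unique : ∀ k {x} → 7 * 2 ^ k ≤ x → x < 7 * 2 ^ (k + 1) → ⌊log₂ x / 7 ⌋ ≡ k
  log-unique k {x} lo hi = ≤-antisym (s≤s⁻¹ below) above
    where
    2^k≤x/7 : 2 ^ k ≤ x / 7
    2^k≤x/7 = begin
      2 ^ k           ≡⟨ m*n/n≡m (2 ^ k) 7 ⟨
      2 ^ k * 7 / 7   ≡⟨ cong (_/ 7) (*-comm (2 ^ k) 7) ⟩
      7 * 2 ^ k / 7   ≤⟨ /-monoˡ-≤ 7 lo ⟩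
      x / 7           ∎

    above : k ≤ ⌊log₂ x / 7 ⌋
    above = subst (_≤ ⌊log₂ x / 7 ⌋) (⌊log₂[2^n]⌋≡n k) (⌊log₂⌋-mono-≤ 2^k≤x/7)

    x/7<2^[k+1] : x / 7 < 2 ^ (k + 1)
    x/7<2^[k+1] = m<n*o⇒m/o<n (subst (x <_) (*-comm 7 (2 ^ (k + 1))) hi)

    below : ⌊log₂ x / 7 ⌋ < suc k
    below = ≰⇒> λ p → <⇒≱ x/7<2^[k+1] (begin
      2 ^ (k + 1)         ≡⟨ cong (2 ^_) (+-comm k 1) ⟩
      2 ^ suc k           ≤⟨ ^-monoʳ-≤ 2 p ⟩
      2 ^ ⌊log₂ x / 7 ⌋   ≤⟨ 2^⌊log₂n⌋≤n (x / 7) {{>-nonZero (≤-trans (m^n>0 2 k) 2^k≤x/7)}} ⟩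
      x / 7               ∎)

{-# OPTIONS --safe #-}
module Submission where

-- For 0 ≤ c ≤ 3 the pairs (a , b) for which (a , b , c) is a 𝒫-position form
-- the graph of an involution Φ c. Beyond an irregular beginning it is
-- x ↦ x ⊕ (c ⊕ t), where t is 2 or 0 according to the parity of ⌊log₂ (x/7)⌋;
-- halving a pile switches t. Such a Φ c preserves the octets {8p, …, 8p + 7},
-- on which t is constant. So the kernel property of the set {b = Φ c a} is a
-- finite check for piles below 56, a finite check for piles in a common octet,
-- and clear for piles in different octets (lower the larger pile).

open import Defs
open import Data.Empty using (⊥)
open import Data.Integer.Base as ℤ using (+_; -1ℤ)
import Data.Integer.Properties as ℤ
open import Data.List.Base as List using (List; []; _∷_; upTo)
open import Data.List.Membership.Propositional using (_∈_)
open import Data.List.Membership.Propositional.Properties using (∈-upTo⁺)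
open import Data.List.Properties using (∷-injective)
open import Data.List.Relation.Unary.Any using (Any; here; there)
open import Data.Nat.Base as ℕ hiding (_/_)
open import Data.Nat.DivMod hiding (_/_)
open import Data.Nat.ListAction using (sum)
open import Data.Nat.ListAction.Properties using (sum-++)
open import Data.Nat.Logarithm
open import Data.Nat.Properties
open import Data.Product using (∃-syntax; _×_; _,_; proj₁; proj₂)
open import Data.Rational.Unnormalised.Base using (_/_)
open import Data.Sum as Sum using (_⊎_; inj₁; inj₂)
open import Function.Bundles using (_⇔_; mk⇔)
open import Function.Construct.Composition using (_⇔-∘_)
open import Relation.Binary.Definitions using (tri<; tri≈; tri>)
open import Relation.Binary.PropositionalEquality
open import Relation.Nullary
open import Relation.Nullary.Decidable using (toWitness)

-- Binary digits

⌊2m+n/2⌋≡m+⌊n/2⌋ : ∀ m n → ⌊ 2 * m + n /2⌋ ≡ m + ⌊ n /2⌋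
⌊2m+n/2⌋≡m+⌊n/2⌋ zero    n = refl
⌊2m+n/2⌋≡m+⌊n/2⌋ (suc m) n =
  trans (cong (λ k → ⌊ k + n /2⌋) (*-suc 2 m)) (cong suc (⌊2m+n/2⌋≡m+⌊n/2⌋ m n))

m<2n⇒⌊m/2⌋<n : ∀ {m} n → m < 2 * n → ⌊ m /2⌋ < n
m<2n⇒⌊m/2⌋<n {zero}        (suc n) _ = z<s
m<2n⇒⌊m/2⌋<n {suc zero}    (suc n) _ = z<s
m<2n⇒⌊m/2⌋<n {suc (suc m)} (suc n) p =
  s<s (m<2n⇒⌊m/2⌋<n n (s<s⁻¹ (s<s⁻¹ (subst (2 + m <_) (*-suc 2 n) p))))

n/2≡⌊n/2⌋ : ∀ n → n ℕ./ 2 ≡ ⌊ n /2⌋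
n/2≡⌊n/2⌋ zero          = refl
n/2≡⌊n/2⌋ (suc zero)    = refl
n/2≡⌊n/2⌋ (suc (suc n)) =
  trans (m/n≡1+[m∸n]/n {2 + n} (s≤s (s≤s z≤n))) (cong suc (n/2≡⌊n/2⌋ n))

n%2+2⌊n/2⌋≡n : ∀ n → n % 2 + 2 * ⌊ n /2⌋ ≡ n
n%2+2⌊n/2⌋≡n n = sym (begin
  n                         ≡⟨ m≡m%n+[m/n]*n n 2 ⟩
  n % 2 + n ℕ./ 2 * 2       ≡⟨ cong (λ h → n % 2 + h * 2) (n/2≡⌊n/2⌋ n) ⟩
  n % 2 + ⌊ n /2⌋ * 2       ≡⟨ cong (_+_ (n % 2)) (*-comm ⌊ n /2⌋ 2) ⟩
  n % 2 + 2 * ⌊ n /2⌋       ∎)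
  where open ≡-Reasoning

[2m+n]%2≡n%2 : ∀ m n → (2 * m + n) % 2 ≡ n % 2
[2m+n]%2≡n%2 m n = trans
  (cong (_% 2) (trans (+-comm (2 * m) n) (cong (_+_ n) (*-comm 2 m))))
  ([m+kn]%n≡m%n n m 2)

⌊n/2⌋-≤-pred : ∀ {n k} → n ≤ suc k → ⌊ n /2⌋ ≤ k
⌊n/2⌋-≤-pred {zero}  _ = z≤n
⌊n/2⌋-≤-pred {suc n} p = s≤s⁻¹ (≤-trans (⌊n/2⌋<n n) p)

⊕-%2 : ∀ m n → (m ⊕ n) % 2 ≡ (m % 2 + n % 2) % 2
⊕-%2 m n = begin
  (m ⊕ n) % 2                                 ≡⟨ cong (_% 2) (⊕-step m n) ⟩
  (d % 2 + 2 * (⌊ m /2⌋ ⊕ ⌊ n /2⌋)) % 2       ≡⟨ cong (_% 2) (+-comm (d % 2) _) ⟩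
  (2 * (⌊ m /2⌋ ⊕ ⌊ n /2⌋) + d % 2) % 2       ≡⟨ [2m+n]%2≡n%2 (⌊ m /2⌋ ⊕ ⌊ n /2⌋) (d % 2) ⟩
  d % 2 % 2                                   ≡⟨ m%n%n≡m%n d 2 ⟩
  d % 2                                       ∎
  where
  open ≡-Reasoning
  d = m % 2 + n % 2

⌊b/2⌋≡0 : ∀ {b} → b < 2 → ⌊ b /2⌋ ≡ 0
⌊b/2⌋≡0 (s≤s z≤n)       = refl
⌊b/2⌋≡0 (s≤s (s≤s z≤n)) = refl

⊕-/2 : ∀ m n → ⌊ m ⊕ n /2⌋ ≡ ⌊ m /2⌋ ⊕ ⌊ n /2⌋
⊕-/2 m n = begin
  ⌊ m ⊕ n /2⌋                                 ≡⟨ cong ⌊_/2⌋ (⊕-step m n) ⟩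
  ⌊ d % 2 + 2 * (⌊ m /2⌋ ⊕ ⌊ n /2⌋) /2⌋       ≡⟨ cong ⌊_/2⌋ (+-comm (d % 2) _) ⟩
  ⌊ 2 * (⌊ m /2⌋ ⊕ ⌊ n /2⌋) + d % 2 /2⌋       ≡⟨ ⌊2m+n/2⌋≡m+⌊n/2⌋ _ (d % 2) ⟩
  (⌊ m /2⌋ ⊕ ⌊ n /2⌋) + ⌊ d % 2 /2⌋           ≡⟨ cong (_+_ _) (⌊b/2⌋≡0 (m%n<n d 2)) ⟩
  (⌊ m /2⌋ ⊕ ⌊ n /2⌋) + 0                     ≡⟨ +-identityʳ _ ⟩
  ⌊ m /2⌋ ⊕ ⌊ n /2⌋                           ∎
  where
  open ≡-Reasoning
  d = m % 2 + n % 2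

⊕-identityʳ : ∀ m → m ⊕ 0 ≡ m
⊕-identityʳ m = go m ≤-refl
  where
  open ≡-Reasoning

  go : ∀ k {m} → m ≤ k → m ⊕ 0 ≡ m
  go zero    z≤n = refl
  go (suc k) {m} m≤k = begin
    m ⊕ 0                                   ≡⟨ ⊕-step m 0 ⟩
    (m % 2 + 0) % 2 + 2 * (⌊ m /2⌋ ⊕ 0)     ≡⟨ cong₂ (λ u v → u % 2 + 2 * v)
                                                 (+-identityʳ (m % 2)) (go k (⌊n/2⌋-≤-pred m≤k)) ⟩
    m % 2 % 2 + 2 * ⌊ m /2⌋                 ≡⟨ cong (_+ 2 * ⌊ m /2⌋) (m%n%n≡m%n m 2) ⟩
    m % 2 + 2 * ⌊ m /2⌋                     ≡⟨ n%2+2⌊n/2⌋≡n m ⟩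
    m                                       ∎

⊕-cancel : ∀ m n → m ⊕ (m ⊕ n) ≡ n
⊕-cancel m n = go (m ⊔ n) (m≤m⊔n m n) (m≤n⊔m m n)
  where
  open ≡-Reasoning

  bits : ∀ {b} → b < 2 → ∀ {c} → c < 2 → (b + (b + c) % 2) % 2 ≡ c
  bits = toWitness
    {a? = allUpTo? (λ b → allUpTo? (λ c → (b + (b + c) % 2) % 2 ≟ c) 2) 2} _

  go : ∀ k {m n} → m ≤ k → n ≤ k → m ⊕ (m ⊕ n) ≡ n
  go zero    z≤n z≤n = refl
  go (suc k) {m} {n} m≤k n≤k = begin
    m ⊕ (m ⊕ n)
      ≡⟨ ⊕-step m (m ⊕ n) ⟩
    (m % 2 + (m ⊕ n) % 2) % 2 + 2 * (⌊ m /2⌋ ⊕ ⌊ m ⊕ n /2⌋)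
      ≡⟨ cong₂ (λ u v → (m % 2 + u) % 2 + 2 * (⌊ m /2⌋ ⊕ v)) (⊕-%2 m n) (⊕-/2 m n) ⟩
    (m % 2 + (m % 2 + n % 2) % 2) % 2 + 2 * (⌊ m /2⌋ ⊕ (⌊ m /2⌋ ⊕ ⌊ n /2⌋))
      ≡⟨ cong₂ (λ u v → u + 2 * v) (bits (m%n<n m 2) (m%n<n n 2))
           (go k (⌊n/2⌋-≤-pred m≤k) (⌊n/2⌋-≤-pred n≤k)) ⟩
    n % 2 + 2 * ⌊ n /2⌋
      ≡⟨ n%2+2⌊n/2⌋≡n n ⟩
    n ∎

-- With `o < 2 ^ k`, `o` has no digit from position `k` on, so the multiple of `2 ^ k` passes
-- through the XOR. Each induction step peels one digit off `s` and `o`.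
⊕-low : ∀ k m s {o} → o < 2 ^ k → (2 ^ k * m + s) ⊕ o ≡ 2 ^ k * m + (s ⊕ o)
⊕-low zero    m s (s≤s z≤n) =
  trans (⊕-identityʳ _) (cong (_+_ (1 * m)) (sym (⊕-identityʳ s)))
⊕-low (suc k) m s {o} o< = begin
  (2 ^ suc k * m + s) ⊕ o
    ≡⟨ cong (λ z → (z + s) ⊕ o) (*-assoc 2 (2 ^ k) m) ⟩
  (2 * M + s) ⊕ o
    ≡⟨ ⊕-step (2 * M + s) o ⟩
  ((2 * M + s) % 2 + o % 2) % 2 + 2 * (⌊ 2 * M + s /2⌋ ⊕ ⌊ o /2⌋)
    ≡⟨ cong₂ (λ u v → (u + o % 2) % 2 + 2 * (v ⊕ ⌊ o /2⌋))
         ([2m+n]%2≡n%2 M s) (⌊2m+n/2⌋≡m+⌊n/2⌋ M s) ⟩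
  d + 2 * ((M + ⌊ s /2⌋) ⊕ ⌊ o /2⌋)
    ≡⟨ cong (λ z → d + 2 * z) (⊕-low k m ⌊ s /2⌋ (m<2n⇒⌊m/2⌋<n (2 ^ k) o<)) ⟩
  d + 2 * (M + (⌊ s /2⌋ ⊕ ⌊ o /2⌋))
    ≡⟨ cong (_+_ d) (*-distribˡ-+ 2 M _) ⟩
  d + (2 * M + 2 * (⌊ s /2⌋ ⊕ ⌊ o /2⌋))
    ≡⟨ +-assoc d (2 * M) _ ⟨
  d + 2 * M + 2 * (⌊ s /2⌋ ⊕ ⌊ o /2⌋)
    ≡⟨ cong (_+ 2 * (⌊ s /2⌋ ⊕ ⌊ o /2⌋)) (+-comm d (2 * M)) ⟩
  2 * M + d + 2 * (⌊ s /2⌋ ⊕ ⌊ o /2⌋)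
    ≡⟨ +-assoc (2 * M) d _ ⟩
  2 * M + (d + 2 * (⌊ s /2⌋ ⊕ ⌊ o /2⌋))
    ≡⟨ cong₂ _+_ (*-assoc 2 (2 ^ k) m) (⊕-step s o) ⟨
  2 ^ suc k * m + (s ⊕ o) ∎
  where
  open ≡-Reasoning
  M = 2 ^ k * m
  d = (s % 2 + o % 2) % 2

-- The blocks 7 · 2 ^ k ≤ x < 7 · 2 ^ (k + 1)

level : ℕ → ℕ
level x = ⌊log₂ x ℕ./ 7 ⌋

-- Halving commutes with division by 7, since both orders give the quotient by 14, and it lowers the
-- logarithm by one. The bound 14 makes the logarithm positive, so the truncated `∸ 1` can be
-- undone.
level-half : ∀ {x} → 14 ≤ x → level x ≡ suc (level ⌊ x /2⌋)
level-half {x} 14≤x = begin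
  level x                             ≡⟨ m+[n∸m]≡n 1≤level ⟨
  suc (level x ∸ 1)                   ≡⟨ cong suc (⌊log₂⌊n/2⌋⌋≡⌊log₂n⌋∸1 (x ℕ./ 7)) ⟨
  suc ⌊log₂ ⌊ x ℕ./ 7 /2⌋ ⌋           ≡⟨ cong (λ z → suc ⌊log₂ z ⌋) swap ⟩
  suc (level ⌊ x /2⌋)                 ∎
  where
  open ≡-Reasoning

  1≤level : 1 ≤ level x
  1≤level = ⌊log₂⌋-mono-≤ {2} (/-monoˡ-≤ 7 14≤x)

  swap : ⌊ x ℕ./ 7 /2⌋ ≡ ⌊ x /2⌋ ℕ./ 7
  swap = begin
    ⌊ x ℕ./ 7 /2⌋     ≡⟨ n/2≡⌊n/2⌋ (x ℕ./ 7) ⟨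
    x ℕ./ 7 ℕ./ 2     ≡⟨ m/n/o≡m/[n*o] x 7 2 ⟩
    x ℕ./ 14          ≡⟨ m/n/o≡m/[n*o] x 2 7 ⟨
    x ℕ./ 2 ℕ./ 7     ≡⟨ cong (ℕ._/ 7) (n/2≡⌊n/2⌋ x) ⟩
    ⌊ x /2⌋ ℕ./ 7     ∎

-- Halving `k` times leads from `2 ^ k * m + s` to `m`, and `7 ≤ m` keeps every number halved on the
-- way at 14 or more.
level-scale : ∀ k {m s} → 7 ≤ m → s < 2 ^ k → level (2 ^ k * m + s) ≡ k + level m
level-scale zero {m} _ (s≤s z≤n) =
  cong level (trans (+-identityʳ (1 * m)) (*-identityˡ m))
level-scale (suc k) {m} {s} 7≤m s< = begin
  level (2 ^ suc k * m + s)             ≡⟨ cong (λ z → level (z + s)) (*-assoc 2 (2 ^ k) m) ⟩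
  level (2 * M + s)                     ≡⟨ level-half 14≤ ⟩
  suc (level ⌊ 2 * M + s /2⌋)           ≡⟨ cong (λ z → suc (level z)) (⌊2m+n/2⌋≡m+⌊n/2⌋ M s) ⟩
  suc (level (M + ⌊ s /2⌋))             ≡⟨ cong suc (level-scale k 7≤m (m<2n⇒⌊m/2⌋<n (2 ^ k) s<)) ⟩
  suc k + level m                       ∎
  where
  open ≡-Reasoning
  M = 2 ^ k * m

  14≤ : 14 ≤ 2 * M + s
  14≤ = ≤-trans (*-monoʳ-≤ 2 (*-mono-≤ (m^n>0 2 k) 7≤m)) (m≤m+n (2 * M) s)

-- For `c = 3` this yields the two rules for φ₃: `3 ⊕ 2` is 1 at even levels, `3 ⊕ 0` is 3 at odd
-- ones.
twist : ℕ → ℕ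
twist zero          = 2
twist (suc zero)    = 0
twist (suc (suc n)) = twist n

twist-suc : ∀ n → twist (suc n) ≡ 2 ∸ twist n
twist-suc zero          = refl
twist-suc (suc zero)    = refl
twist-suc (suc (suc n)) = twist-suc n

-- Turns the twist into a bit `j`, over which the finite checks on octets range.
twist-even : ∀ n → ∃[ j ] j < 2 × twist n ≡ 2 * j
twist-even zero          = 1 , s≤s (s≤s z≤n) , refl
twist-even (suc zero)    = 0 , s≤s z≤n , refl
twist-even (suc (suc n)) = twist-even n

-- The involutions Φ c

-- The default 0 is never reached: `Φ` looks up only indices below 30, and each row has 30 entries.
nth : List ℕ → ℕ → ℕ
nth []       _       = 0
nth (x ∷ xs) zero    = x
nth (x ∷ xs) (suc n) = nth xs n

-- Rows 0, 1, 2 were found by computing the 𝒫-positions; row 3, which is also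
-- the junk value for c > 3, is the list given for φ₃.
beginning : ℕ → List ℕ
beginning 0 =
  0 ∷ 2 ∷ 1 ∷ 3 ∷ 4 ∷ 5 ∷ 8 ∷ 9 ∷ 6 ∷ 7 ∷
  12 ∷ 13 ∷ 10 ∷ 11 ∷ 14 ∷ 15 ∷ 16 ∷ 17 ∷ 18 ∷ 19 ∷
  20 ∷ 21 ∷ 22 ∷ 23 ∷ 24 ∷ 25 ∷ 26 ∷ 27 ∷ 30 ∷ 31 ∷ []
beginning 1 =
  2 ∷ 3 ∷ 0 ∷ 1 ∷ 5 ∷ 4 ∷ 9 ∷ 8 ∷ 7 ∷ 6 ∷
  13 ∷ 12 ∷ 11 ∷ 10 ∷ 15 ∷ 14 ∷ 17 ∷ 16 ∷ 19 ∷ 18 ∷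
  21 ∷ 20 ∷ 23 ∷ 22 ∷ 25 ∷ 24 ∷ 27 ∷ 26 ∷ 31 ∷ 30 ∷ []
beginning 2 =
  1 ∷ 0 ∷ 2 ∷ 4 ∷ 3 ∷ 6 ∷ 5 ∷ 7 ∷ 8 ∷ 9 ∷
  10 ∷ 11 ∷ 12 ∷ 13 ∷ 18 ∷ 19 ∷ 20 ∷ 21 ∷ 14 ∷ 15 ∷
  16 ∷ 17 ∷ 26 ∷ 27 ∷ 28 ∷ 29 ∷ 22 ∷ 23 ∷ 24 ∷ 25 ∷ []
beginning _ =
  3 ∷ 1 ∷ 4 ∷ 0 ∷ 2 ∷ 7 ∷ 6 ∷ 5 ∷ 9 ∷ 8 ∷
  11 ∷ 10 ∷ 13 ∷ 12 ∷ 19 ∷ 18 ∷ 21 ∷ 20 ∷ 15 ∷ 14 ∷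
  17 ∷ 16 ∷ 27 ∷ 26 ∷ 29 ∷ 28 ∷ 23 ∷ 22 ∷ 25 ∷ 24 ∷ []

opaque
  Φ : ℕ → ℕ → ℕ
  Φ c x with x <? 30
  ... | yes _ = nth (beginning c) x
  ... | no  _ = x ⊕ (c ⊕ twist (level x))

  Φ-regular : ∀ c {x} → 30 ≤ x → Φ c x ≡ x ⊕ (c ⊕ twist (level x))
  Φ-regular c {x} 30≤x with x <? 30
  ... | yes x<30 = contradiction 30≤x (<⇒≱ x<30)
  ... | no  _    = refl

-- Some move leads to the graph of Φ: in the second, first or third pile, or
-- the halving.
Winning : ℕ → ℕ → ℕ → Set
Winning c a b =
  Φ c a < b ⊎ Φ c b < a ⊎ (∃[ d ] d < c × Φ d a ≡ b) ⊎ Φ ⌊ c /2⌋ ⌊ a /2⌋ ≡ ⌊ b /2⌋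

-- Finite checks for piles below 56

opaque
  unfolding Φ

  Φ-origin : Φ 0 0 ≡ 0
  Φ-origin = refl

  Φ-regular-28,29 : ∀ {c} → c < 2 → ∀ {x} → x < 30 → 28 ≤ x →
                    Φ c x ≡ x ⊕ (c ⊕ twist (level x))
  Φ-regular-28,29 = toWitness
    {a? = allUpTo? (λ c → allUpTo? (λ x →
      (28 ≤? x) →-dec (Φ c x ≟ x ⊕ (c ⊕ twist (level x)))) 30) 2} _

  -- 56 is `8 * 7`, the start of the first octet whose index meets the bound `7 ≤ m` of
  -- `level-scale`. If only one of two piles is below 56, the other can be lowered to its partner.
  Φ<56 : ∀ {c} → c < 4 → ∀ {a} → a < 56 → Φ c a < 56
  Φ<56 = toWitness
    {a? = allUpTo? (λ c → allUpTo? (λ a → Φ c a <? 56) 56) 4} _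

  Φ-involutive-<56 : ∀ {c} → c < 4 → ∀ {a} → a < 56 → Φ c (Φ c a) ≡ a
  Φ-involutive-<56 = toWitness
    {a? = allUpTo? (λ c → allUpTo? (λ a → Φ c (Φ c a) ≟ a) 56) 4} _

  Φ-distinct-<56 : ∀ {c} → c < 4 → ∀ {d} → d < c → ∀ {a} → a < 56 → Φ d a ≢ Φ c a
  Φ-distinct-<56 = toWitness
    {a? = allUpTo? (λ c → allUpTo? (λ d → allUpTo? (λ a →
      ¬? (Φ d a ≟ Φ c a)) 56) c) 4} _

  -- The exception is the empty position, which halving would fix but which has no move.
  Φ-halve-<56 : ∀ {c} → c < 4 → ∀ {a} → a < 56 →
                ⌊ Φ c a /2⌋ ≡ Φ ⌊ c /2⌋ ⌊ a /2⌋ → c ≡ 0 × a ≡ 0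
  Φ-halve-<56 = toWitness
    {a? = allUpTo? (λ c → allUpTo? (λ a →
      (⌊ Φ c a /2⌋ ≟ Φ ⌊ c /2⌋ ⌊ a /2⌋) →-dec (c ≟ 0 ×-dec a ≟ 0)) 56) 4} _

  winning-<56 : ∀ {c} → c < 4 → ∀ {a} → a < 56 → ∀ {b} → b < 56 → b ≡ Φ c a ⊎ Winning c a b
  winning-<56 = toWitness
    {a? = allUpTo? (λ c → allUpTo? (λ a → allUpTo? (λ b →
      b ≟ Φ c a ⊎-dec Φ c a <? b ⊎-dec Φ c b <? a
        ⊎-dec anyUpTo? (λ d → Φ d a ≟ b) c
        ⊎-dec Φ ⌊ c /2⌋ ⌊ a /2⌋ ≟ ⌊ b /2⌋) 56) 56) 4} _

  map-Φ₃ : List.map (Φ 3) (upTo 30) ≡ beginning 3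
  map-Φ₃ = refl

-- For c < 2 the regular behaviour starts earlier; this is what the halves of
-- the octets above 56 need.
Φ-regular₂₈ : ∀ {c x} → c < 2 → 28 ≤ x → Φ c x ≡ x ⊕ (c ⊕ twist (level x))
Φ-regular₂₈ {c} {x} c<2 28≤x with 30 ≤? x
... | yes 30≤x = Φ-regular c 30≤x
... | no  30≰x = Φ-regular-28,29 c<2 (≰⇒> 30≰x) 28≤x

-- The maps induced by Φ c on {8p, …, 8p + 7} and by Φ ⌊ c /2⌋ on its half, in
-- terms of the offsets; 2 * j is the twist of the half.
opaque
  octet : ℕ → ℕ → ℕ → ℕ
  octet j c s = s ⊕ (c ⊕ (2 ∸ 2 * j))

  half-octet : ℕ → ℕ → ℕ → ℕ
  half-octet j c s = ⌊ s /2⌋ ⊕ (⌊ c /2⌋ ⊕ 2 * j)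

  octet<8 : ∀ {j} → j < 2 → ∀ {c} → c < 4 → ∀ {s} → s < 8 → octet j c s < 8
  octet<8 = toWitness
    {a? = allUpTo? (λ j → allUpTo? (λ c → allUpTo? (λ s → octet j c s <? 8) 8) 4) 2} _

  octet-involutive : ∀ {j} → j < 2 → ∀ {c} → c < 4 → ∀ {s} → s < 8 →
                     octet j c (octet j c s) ≡ s
  octet-involutive = toWitness
    {a? = allUpTo? (λ j → allUpTo? (λ c → allUpTo? (λ s →
      octet j c (octet j c s) ≟ s) 8) 4) 2} _

  octet-distinct : ∀ {j} → j < 2 → ∀ {c} → c < 4 → ∀ {d} → d < c → ∀ {s} → s < 8 →
                   octet j d s ≢ octet j c s
  octet-distinct = toWitness
    {a? = allUpTo? (λ j → allUpTo? (λ c → allUpTo? (λ d → allUpTo? (λ s →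
      ¬? (octet j d s ≟ octet j c s)) 8) c) 4) 2} _

  -- Halving turns the twist `2 ∸ 2 * j` into `1 ∸ j`, while the half demands `2 * j`. These are 1
  -- and 0, or 0 and 2, so they never agree.
  octet-halve : ∀ {j} → j < 2 → ∀ {c} → c < 4 → ∀ {s} → s < 8 →
                ⌊ octet j c s /2⌋ ≢ half-octet j c s
  octet-halve = toWitness
    {a? = allUpTo? (λ j → allUpTo? (λ c → allUpTo? (λ s →
      ¬? (⌊ octet j c s /2⌋ ≟ half-octet j c s)) 8) 4) 2} _

  -- For `j = 1` the octet has twist 0 and this is ordinary Nim. For `j = 0` the twist acts as an
  -- extra Nim pile of size 2. A Nim move in that pile would require `s ⊕ r ⊕ c < 2`; halving takes
  -- its place, since the halves then have XOR 0, which is the twist of the half.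
  octet-winning : ∀ {j} → j < 2 → ∀ {c} → c < 4 → ∀ {s} → s < 8 → ∀ {r} → r < 8 →
    r ≡ octet j c s ⊎ octet j c s < r ⊎ octet j c r < s
    ⊎ (∃[ d ] d < c × octet j d s ≡ r) ⊎ half-octet j c s ≡ ⌊ r /2⌋
  octet-winning = toWitness
    {a? = allUpTo? (λ j → allUpTo? (λ c → allUpTo? (λ s → allUpTo? (λ r →
      r ≟ octet j c s ⊎-dec octet j c s <? r ⊎-dec octet j c r <? s
        ⊎-dec anyUpTo? (λ d → octet j d s ≟ r) c
        ⊎-dec half-octet j c s ≟ ⌊ r /2⌋) 8) 8) 4) 2} _

opaque
  unfolding octet half-octet

  -- The level is constant on the octet and on its half, and the XOR offsets have at most three and
  -- two digits respectively. So `⊕-low` leaves `8 * p` and `4 * p` intact.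
  Φ-octet : ∀ {p} → 7 ≤ p → ∃[ j ] j < 2 ×
    (∀ {c} → c < 4 → ∀ {s} → s < 8 →
      Φ c (8 * p + s) ≡ 8 * p + octet j c s ×
      Φ ⌊ c /2⌋ ⌊ 8 * p + s /2⌋ ≡ 4 * p + half-octet j c s)
  Φ-octet {p} 7≤p with twist-even (2 + level p)
  -- `2 + level p` is the level of the half. The octet lies one level higher, so its twist is
  -- `2 ∸ 2 * j`.
  ... | j , j<2 , e = j , j<2 , λ c<4 s<8 → whole c<4 s<8 , half c<4 s<8
    where
    open ≡-Reasoning

    offset<8 : ∀ {j} → j < 2 → ∀ {c} → c < 4 → c ⊕ (2 ∸ 2 * j) < 8
    offset<8 = toWitness
      {a? = allUpTo? (λ j → allUpTo? (λ c → c ⊕ (2 ∸ 2 * j) <? 8) 4) 2} _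

    offset<4 : ∀ {j} → j < 2 → ∀ {c} → c < 4 → ⌊ c /2⌋ ⊕ 2 * j < 4
    offset<4 = toWitness
      {a? = allUpTo? (λ j → allUpTo? (λ c → ⌊ c /2⌋ ⊕ 2 * j <? 4) 4) 2} _

    whole : ∀ {c} → c < 4 → ∀ {s} → s < 8 → Φ c (8 * p + s) ≡ 8 * p + octet j c s
    whole {c} c<4 {s} s<8 = begin
      Φ c (8 * p + s)
        ≡⟨ Φ-regular c (≤-trans (m≤n+m 30 26) (≤-trans (*-monoʳ-≤ 8 7≤p) (m≤m+n (8 * p) s))) ⟩
      (8 * p + s) ⊕ (c ⊕ twist (level (8 * p + s)))
        ≡⟨ cong (λ k → (8 * p + s) ⊕ (c ⊕ twist k)) (level-scale 3 7≤p s<8) ⟩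
      (8 * p + s) ⊕ (c ⊕ twist (suc (2 + level p)))
        ≡⟨ cong (λ t → (8 * p + s) ⊕ (c ⊕ t)) (trans (twist-suc (2 + level p)) (cong (2 ∸_) e)) ⟩
      (8 * p + s) ⊕ (c ⊕ (2 ∸ 2 * j))
        ≡⟨ ⊕-low 3 p s (offset<8 j<2 c<4) ⟩
      8 * p + octet j c s ∎

    half : ∀ {c} → c < 4 → ∀ {s} → s < 8 →
           Φ ⌊ c /2⌋ ⌊ 8 * p + s /2⌋ ≡ 4 * p + half-octet j c s
    half {c} c<4 {s} s<8 = begin
      Φ ⌊ c /2⌋ ⌊ 8 * p + s /2⌋
        ≡⟨ cong (λ z → Φ ⌊ c /2⌋ ⌊ z + s /2⌋) (*-assoc 2 4 p) ⟩
      Φ ⌊ c /2⌋ ⌊ 2 * (4 * p) + s /2⌋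
        ≡⟨ cong (Φ ⌊ c /2⌋) (⌊2m+n/2⌋≡m+⌊n/2⌋ (4 * p) s) ⟩
      Φ ⌊ c /2⌋ x
        ≡⟨ Φ-regular₂₈ (m<2n⇒⌊m/2⌋<n 2 c<4) (≤-trans (*-monoʳ-≤ 4 7≤p) (m≤m+n (4 * p) ⌊ s /2⌋)) ⟩
      x ⊕ (⌊ c /2⌋ ⊕ twist (level x))
        ≡⟨ cong (λ k → x ⊕ (⌊ c /2⌋ ⊕ twist k)) (level-scale 2 7≤p (m<2n⇒⌊m/2⌋<n 4 s<8)) ⟩
      x ⊕ (⌊ c /2⌋ ⊕ twist (2 + level p))
        ≡⟨ cong (λ t → x ⊕ (⌊ c /2⌋ ⊕ t)) e ⟩
      x ⊕ (⌊ c /2⌋ ⊕ 2 * j)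
        ≡⟨ ⊕-low 2 p ⌊ s /2⌋ (offset<4 j<2 c<4) ⟩
      4 * p + half-octet j c s ∎
      where
      x : ℕ
      x = 4 * p + ⌊ s /2⌋

-- The kernel property for piles of any size

⌊8p+s/2⌋≡4p+⌊s/2⌋ : ∀ p s → ⌊ 8 * p + s /2⌋ ≡ 4 * p + ⌊ s /2⌋
⌊8p+s/2⌋≡4p+⌊s/2⌋ p s =
  trans (cong (λ z → ⌊ z + s /2⌋) (*-assoc 2 4 p)) (⌊2m+n/2⌋≡m+⌊n/2⌋ (4 * p) s)

-- A view: matching on it replaces the index by `8 * p + s`.
data Octet : ℕ → Set where
  octet-of : ∀ p → 7 ≤ p → ∀ {s} → s < 8 → Octet (8 * p + s)

toOctet : ∀ {x} → 56 ≤ x → Octet x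
toOctet {x} 56≤x = subst Octet
  (sym (trans (m≡m%n+[m/n]*n x 8)
    (trans (+-comm (x % 8) _) (cong (_+ x % 8) (*-comm (x ℕ./ 8) 8)))))
  (octet-of (x ℕ./ 8) (/-monoˡ-≤ 8 56≤x) (m%n<n x 8))

octet-< : ∀ {p q s r} → p < q → s < 8 → 8 * p + s < 8 * q + r
octet-< {p} {q} {s} {r} p<q s<8 = begin-strict
  8 * p + s   <⟨ +-monoʳ-< (8 * p) s<8 ⟩
  8 * p + 8   ≡⟨ +-comm (8 * p) 8 ⟩
  8 + 8 * p   ≡⟨ *-suc 8 p ⟨
  8 * suc p   ≤⟨ *-monoʳ-≤ 8 p<q ⟩
  8 * q       ≤⟨ m≤m+n (8 * q) r ⟩
  8 * q + r   ∎
  where open ≤-Reasoning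

small-or-octet : ∀ x → x < 56 ⊎ Octet x
small-or-octet x with 56 ≤? x
... | yes 56≤x = inj₂ (toOctet 56≤x)
... | no  56≰x = inj₁ (≰⇒> 56≰x)

Φ-involutive : ∀ {c} → c < 4 → ∀ a → Φ c (Φ c a) ≡ a
Φ-involutive {c} c<4 a with small-or-octet a
... | inj₁ a<56 = Φ-involutive-<56 c<4 a<56
... | inj₂ (octet-of p 7≤p {s} s<8) = let j , j<2 , rule = Φ-octet 7≤p in begin
  Φ c (Φ c (8 * p + s))             ≡⟨ cong (Φ c) (proj₁ (rule c<4 s<8)) ⟩
  Φ c (8 * p + octet j c s)         ≡⟨ proj₁ (rule c<4 (octet<8 j<2 c<4 s<8)) ⟩
  8 * p + octet j c (octet j c s)   ≡⟨ cong (_+_ (8 * p)) (octet-involutive j<2 c<4 s<8) ⟩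
  8 * p + s                         ∎
  where open ≡-Reasoning

Φ-distinct : ∀ {c} → c < 4 → ∀ {d} → d < c → ∀ a → Φ d a ≢ Φ c a
Φ-distinct {c} c<4 {d} d<c a e with small-or-octet a
... | inj₁ a<56 = Φ-distinct-<56 c<4 d<c a<56 e
... | inj₂ (octet-of p 7≤p {s} s<8) =
  let j , j<2 , rule = Φ-octet 7≤p in
  octet-distinct j<2 c<4 d<c s<8 (+-cancelˡ-≡ (8 * p) _ _ (begin
    8 * p + octet j d s   ≡⟨ proj₁ (rule (<-trans d<c c<4) s<8) ⟨
    Φ d (8 * p + s)       ≡⟨ e ⟩
    Φ c (8 * p + s)       ≡⟨ proj₁ (rule c<4 s<8) ⟩
    8 * p + octet j c s   ∎))
  where open ≡-Reasoning

Φ-halve : ∀ {c} → c < 4 → ∀ a →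
          ⌊ Φ c a /2⌋ ≡ Φ ⌊ c /2⌋ ⌊ a /2⌋ → c ≡ 0 × a ≡ 0
Φ-halve {c} c<4 a e with small-or-octet a
... | inj₁ a<56 = Φ-halve-<56 c<4 a<56 e
... | inj₂ (octet-of p 7≤p {s} s<8) =
  let j , j<2 , rule = Φ-octet 7≤p in
  contradiction
    (+-cancelˡ-≡ (4 * p) _ _ (begin
      4 * p + ⌊ octet j c s /2⌋   ≡⟨ ⌊8p+s/2⌋≡4p+⌊s/2⌋ p (octet j c s) ⟨
      ⌊ 8 * p + octet j c s /2⌋   ≡⟨ cong ⌊_/2⌋ (proj₁ (rule c<4 s<8)) ⟨
      ⌊ Φ c (8 * p + s) /2⌋       ≡⟨ e ⟩
      Φ ⌊ c /2⌋ ⌊ 8 * p + s /2⌋   ≡⟨ proj₂ (rule c<4 s<8) ⟩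
      4 * p + half-octet j c s    ∎))
    (octet-halve j<2 c<4 s<8)
  where open ≡-Reasoning

-- `Φ c` preserves the octet, so a bound on all its members bounds the image.
Φ-octet-< : ∀ {c p b s} → c < 4 → 7 ≤ p → s < 8 →
            (∀ {t} → t < 8 → 8 * p + t < b) → Φ c (8 * p + s) < b
Φ-octet-< {b = b} c<4 7≤p s<8 below =
  let j , j<2 , rule = Φ-octet 7≤p in
  subst (_< b) (sym (proj₁ (rule c<4 s<8))) (below (octet<8 j<2 c<4 s<8))

winning-octet : ∀ {c p s r} → c < 4 → 7 ≤ p → s < 8 → r < 8 →
  8 * p + r ≡ Φ c (8 * p + s) ⊎ Winning c (8 * p + s) (8 * p + r)
winning-octet {c} {p} {s} {r} c<4 7≤p s<8 r<8 =
  let j , j<2 , rule = Φ-octet 7≤p in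
  Sum.map
    (λ e → trans (cong (_+_ (8 * p)) e) (sym (proj₁ (rule c<4 s<8))))
    (Sum.map
      (λ l → subst (_< 8 * p + r) (sym (proj₁ (rule c<4 s<8))) (+-monoʳ-< (8 * p) l))
      (Sum.map
        (λ l → subst (_< 8 * p + s) (sym (proj₁ (rule c<4 r<8))) (+-monoʳ-< (8 * p) l))
        (Sum.map
          (λ (d , d<c , e) → d , d<c ,
            trans (proj₁ (rule (<-trans d<c c<4) s<8)) (cong (_+_ (8 * p)) e))
          (λ e → trans (proj₂ (rule c<4 s<8))
            (trans (cong (_+_ (4 * p)) e) (sym (⌊8p+s/2⌋≡4p+⌊s/2⌋ p r)))))))
    (octet-winning j<2 c<4 s<8 r<8)

winning : ∀ {c} → c < 4 → ∀ a b → b ≡ Φ c a ⊎ Winning c a b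
winning {c} c<4 a b with small-or-octet a | small-or-octet b
... | inj₁ a<56 | inj₁ b<56 = winning-<56 c<4 a<56 b<56
... | inj₁ a<56 | inj₂ (octet-of q 7≤q {r} _) =
  inj₂ (inj₁ (≤-trans (Φ<56 c<4 a<56) (≤-trans (*-monoʳ-≤ 8 7≤q) (m≤m+n (8 * q) r))))
... | inj₂ (octet-of p 7≤p {s} _) | inj₁ b<56 =
  inj₂ (inj₂ (inj₁ (≤-trans (Φ<56 c<4 b<56) (≤-trans (*-monoʳ-≤ 8 7≤p) (m≤m+n (8 * p) s)))))
... | inj₂ (octet-of p 7≤p s<8) | inj₂ (octet-of q 7≤q r<8) with <-cmp p q
...   | tri< p<q _ _  = inj₂ (inj₁ (Φ-octet-< c<4 7≤p s<8 (octet-< p<q)))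
...   | tri> _ _ q<p  = inj₂ (inj₂ (inj₁ (Φ-octet-< c<4 7≤q r<8 (octet-< q<p))))
...   | tri≈ _ refl _ = winning-octet c<4 7≤p s<8 r<8

-- The game

⟶-sum : ∀ {p q} → p ⟶ q → sum q < sum p
⟶-sum (remove ps {m} {k} qs k<m) =
  subst₂ _<_ (sym (sum-++ ps (k ∷ qs))) (sym (sum-++ ps (m ∷ qs)))
    (+-monoʳ-< (sum ps) (+-monoˡ-< (sum qs) k<m))
⟶-sum (halve some) = halved some
  where
  halved-≤ : ∀ ps → sum (List.map ⌊_/2⌋ ps) ≤ sum ps
  halved-≤ []       = z≤n
  halved-≤ (m ∷ ps) = +-mono-≤ (⌊n/2⌋≤n m) (halved-≤ ps)

  halved : ∀ {ps} → Any (0 <_) ps → sum (List.map ⌊_/2⌋ ps) < sum ps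
  halved {suc m ∷ ps} (here _)  = +-mono-<-≤ (⌊n/2⌋<n m) (halved-≤ ps)
  halved {m ∷ ps}     (there x) = +-mono-≤-< (⌊n/2⌋≤n m) (halved x)

disjoint : ∀ {p} → 𝒫-position p → 𝒩-position p → ⊥
disjoint (𝒫 f) (𝒩 q move win) = disjoint win (f q move)

module _ {c} (c<4 : c < 4) where

  -- The position `p` enters through an equation because `ps ++ m ∷ qs` cannot be unified with a
  -- list of three piles. Splitting on `ps` then tells which pile is reduced.
  stay-off : ∀ {p q a b} → p ⟶ q → p ≡ a ∷ b ∷ c ∷ [] → b ≡ Φ c a →
    ∃[ d ] ∃[ x ] ∃[ y ] d < 4 × y ≢ Φ d x × q ≡ x ∷ y ∷ d ∷ []
  stay-off {a = a} (remove [] {k = k} _ k<a) refl refl =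
    c , k , Φ c a , c<4 ,
    -- If `Φ c k` equalled `Φ c a`, applying `Φ c` once more would give `k ≡ a`.
    (λ e → <⇒≢ k<a (trans (sym (Φ-involutive c<4 k))
                      (trans (cong (Φ c) (sym e)) (Φ-involutive c<4 a)))) ,
    refl
  stay-off {a = a} (remove (_ ∷ []) {k = k} _ k<b) refl refl =
    c , a , k , c<4 , <⇒≢ k<b , refl
  stay-off {a = a} (remove (_ ∷ _ ∷ []) {k = k} _ k<c) refl refl =
    k , a , Φ c a , <-trans k<c c<4 , (λ e → Φ-distinct c<4 k<c a (sym e)) , refl
  stay-off (remove (_ ∷ _ ∷ _ ∷ [])      _ _) () _
  stay-off (remove (_ ∷ _ ∷ _ ∷ _ ∷ _)   _ _) () _
  stay-off {a = a} (halve some) refl refl =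
    ⌊ c /2⌋ , ⌊ a /2⌋ , ⌊ Φ c a /2⌋ , ≤-<-trans (⌊n/2⌋≤n c) c<4 ,
    (λ e → nonzero (Φ-halve c<4 a e) some) , refl
    where
    nonzero : ∀ {c a} → c ≡ 0 × a ≡ 0 → ¬ Any (0 <_) (a ∷ Φ c a ∷ c ∷ [])
    nonzero (refl , refl) (here ())
    nonzero (refl , refl) (there (here l)) = contradiction (sym Φ-origin) (<⇒≢ l)
    nonzero (refl , refl) (there (there (here ())))

  get-on : ∀ a b → b ≢ Φ c a →
    ∃[ d ] ∃[ x ] ∃[ y ] d < 4 × y ≡ Φ d x × (a ∷ b ∷ c ∷ []) ⟶ (x ∷ y ∷ d ∷ [])
  get-on a b off with winning c<4 a b
  ... | inj₁ e = contradiction e off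
  ... | inj₂ (inj₁ l) = c , a , Φ c a , c<4 , refl , remove (a ∷ []) (c ∷ []) l
  -- Lowering the first pile to `Φ c b` reaches the graph because `Φ c` is an involution.
  ... | inj₂ (inj₂ (inj₁ l)) =
    c , Φ c b , b , c<4 , sym (Φ-involutive c<4 b) , remove [] (b ∷ c ∷ []) l
  ... | inj₂ (inj₂ (inj₂ (inj₁ (d , d<c , e)))) =
    d , a , b , <-trans d<c c<4 , sym e , remove (a ∷ b ∷ []) [] d<c
  ... | inj₂ (inj₂ (inj₂ (inj₂ e))) =
    ⌊ c /2⌋ , ⌊ a /2⌋ , ⌊ b /2⌋ , ≤-<-trans (⌊n/2⌋≤n c) c<4 , sym e , halve (some a b c off)
    where
    some : ∀ a b c → b ≢ Φ c a → Any (0 <_) (a ∷ b ∷ c ∷ [])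
    some (suc _) _       _       _   = here z<s
    some zero    (suc _) _       _   = there (here z<s)
    some zero    zero    (suc _) _   = there (there (here z<s))
    some zero    zero    zero    off = contradiction (sym Φ-origin) off

-- Every move lowers the number of coins, so a strict bound `n` on it gives structural recursion.
-- All `c < 4` are treated at once, as play may change the third pile.
outcome : ∀ n {c} → c < 4 → ∀ a b → sum (a ∷ b ∷ c ∷ []) < n →
  (b ≡ Φ c a → 𝒫-position (a ∷ b ∷ c ∷ [])) × (b ≢ Φ c a → 𝒩-position (a ∷ b ∷ c ∷ []))
outcome (suc n) {c} c<4 a b bound = lose , win
  where
  lose : b ≡ Φ c a → 𝒫-position (a ∷ b ∷ c ∷ [])
  lose on = 𝒫 reply
    where
    reply : ∀ q → (a ∷ b ∷ c ∷ []) ⟶ q → 𝒩-position q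
    reply q move with stay-off c<4 move refl on
    ... | d , x , y , d<4 , off , refl =
      proj₂ (outcome n d<4 x y (<-≤-trans (⟶-sum move) (s≤s⁻¹ bound))) off

  win : b ≢ Φ c a → 𝒩-position (a ∷ b ∷ c ∷ [])
  win off with get-on c<4 a b off
  ... | d , x , y , d<4 , on , move =
    𝒩 _ move (proj₁ (outcome n d<4 x y (<-≤-trans (⟶-sum move) (s≤s⁻¹ bound))) on)

-- Off the graph the position is an 𝒩-position, and no position is of both kinds; equality being
-- decidable, this gives the forward direction.
𝒫⇔Φ : ∀ {c} → c < 4 → ∀ a b → 𝒫-position (a ∷ b ∷ c ∷ []) ⇔ b ≡ Φ c a
𝒫⇔Φ {c} c<4 a b = mk⇔ on (proj₁ out)
  where
  out = outcome (suc (sum (a ∷ b ∷ c ∷ []))) c<4 a b ≤-refl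

  on : 𝒫-position (a ∷ b ∷ c ∷ []) → b ≡ Φ c a
  on lost with b ≟ Φ c a
  ... | yes e = e
  ... | no  e = contradiction (proj₂ out e) (disjoint lost)

-- Comparison with φ₃

-- The forms `2 * m` and `2 * m + 1` are those of the exponents in `IsΦ₃`.
twist-parity : ∀ n → (∃[ m ] n ≡ 2 * m × twist n ≡ 2) ⊎ (∃[ m ] n ≡ 2 * m + 1 × twist n ≡ 0)
twist-parity zero          = inj₁ (0 , refl , refl)
twist-parity (suc zero)    = inj₂ (0 , refl , refl)
twist-parity (suc (suc n)) with twist-parity n
... | inj₁ (m , e , t) = inj₁ (suc m , trans (cong (_+_ 2) e) (sym (*-suc 2 m)) , t)
... | inj₂ (m , e , t) = inj₂ (suc m , trans (cong (_+_ 2) e) (cong (_+ 1) (sym (*-suc 2 m))) , t)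

level-lower : ∀ {x} → 7 ≤ x → 7 * 2 ^ level x ≤ x
level-lower {x} 7≤x = begin
  7 * 2 ^ level x   ≤⟨ *-monoʳ-≤ 7 (2^⌊log₂n⌋≤n (x ℕ./ 7) {{>-nonZero (/-monoˡ-≤ 7 7≤x)}}) ⟩
  7 * (x ℕ./ 7)     ≡⟨ *-comm 7 (x ℕ./ 7) ⟩
  x ℕ./ 7 * 7       ≤⟨ m/n*n≤m x 7 ⟩
  x                 ∎
  where open ≤-Reasoning

level-upper : ∀ x → x < 7 * 2 ^ (level x + 1)
level-upper x = begin-strict
  x                             ≡⟨ m≡m%n+[m/n]*n x 7 ⟩
  x % 7 + x ℕ./ 7 * 7           <⟨ +-monoˡ-< (x ℕ./ 7 * 7) (m%n<n x 7) ⟩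
  suc (x ℕ./ 7) * 7             ≤⟨ *-monoˡ-≤ 7 (n<2^[1+⌊log₂n⌋] (x ℕ./ 7)) ⟩
  2 ^ (level x + 1) * 7         ≡⟨ *-comm (2 ^ (level x + 1)) 7 ⟩
  7 * 2 ^ (level x + 1)         ∎
  where open ≤-Reasoning

map-≡⇒≗ : ∀ {A B : Set} {f g : A → B} {xs} → List.map f xs ≡ List.map g xs →
          ∀ {x} → x ∈ xs → f x ≡ g x
map-≡⇒≗ {xs = _ ∷ _} e (here refl) = proj₁ (∷-injective e)
map-≡⇒≗ {xs = _ ∷ _} e (there x∈)  = map-≡⇒≗ (proj₂ (∷-injective e)) x∈

IsΦ₃⇒≗Φ : ∀ {φ} → IsΦ₃ φ → ∀ x → φ x ≡ Φ 3 x
IsΦ₃⇒≗Φ {φ} isφ x with 30 ≤? x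
... | no 30≰x = map-≡⇒≗ {f = φ} {g = Φ 3} (trans below-30 (sym map-Φ₃)) (∈-upTo⁺ (≰⇒> 30≰x))
  where open IsΦ₃ isφ
... | yes 30≤x = trans regular (sym (Φ-regular 3 30≤x))
  where
  open IsΦ₃ isφ

  lower : 7 * 2 ^ level x ≤ x
  lower = level-lower (≤-trans (m≤n+m 7 23) 30≤x)

  2≤level : 2 ≤ level x
  2≤level = ⌊log₂⌋-mono-≤ {4} (/-monoˡ-≤ 7 30≤x)

  regular : φ x ≡ x ⊕ (3 ⊕ twist (level x))
  -- Abstracting `level x` together with all facts about it lets `refl` replace it by `2 * m` or
  -- `2 * m + 1`. Levels 0 and 1 contradict `2≤k`.
  regular with level x | 2≤level | lower | level-upper x | twist-parity (level x)
  ... | _ | 2≤k | lo | hi | inj₁ (zero , refl , _) = contradiction 2≤k λ ()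
  -- Level 2 is the range from 28 to 55, so with `30≤x` it falls under the separate range of
  -- `xor-1`.
  ... | _ | 2≤k | lo | hi | inj₁ (suc zero , refl , t) rewrite t =
    xor-1 x (inj₁ (30≤x , hi))
  ... | _ | 2≤k | lo | hi | inj₁ (suc (suc m) , refl , t) rewrite t =
    xor-1 x (inj₂ (2 + m , s≤s (s≤s z≤n) , lo , hi))
  ... | _ | 2≤k | lo | hi | inj₂ (zero , refl , _) = contradiction 2≤k λ { (s≤s ()) }
  -- The level `2 * suc m + 1` is `2 * n ∸ 1` for `n = 2 + m`.
  ... | _ | 2≤k | lo | hi | inj₂ (suc m , refl , t) rewrite t =
    xor-3 x (2 + m , s≤s (s≤s z≤n) ,
      subst (λ k → 7 * 2 ^ k ≤ x) (trans (sym (m+n∸n≡m (2 * suc m + 1) 1)) (cong (_∸ 1) e)) lo ,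
      subst (λ k → x < 7 * 2 ^ k) e hi)
    where
    e : 2 * suc m + 1 + 1 ≡ 2 * (2 + m)
    e = trans (+-assoc (2 * suc m) 1 1) (trans (+-comm (2 * suc m) 2) (sym (*-suc 2 (suc m))))

-- Both sides have period 2 in `n`, with values 1 and 3.
2+[-1]^[1+n] : ∀ n → + 2 ℤ.+ -1ℤ ℤ.^ (n + 1) ≡ + (3 ⊕ twist n)
2+[-1]^[1+n] zero          = refl
2+[-1]^[1+n] (suc zero)    = refl
2+[-1]^[1+n] (suc (suc n)) = trans
  (cong (ℤ._+_ (+ 2)) (trans (sym (ℤ.*-assoc -1ℤ -1ℤ (-1ℤ ℤ.^ (n + 1)))) (ℤ.*-identityˡ _)))
  (2+[-1]^[1+n] n)

theorem21 : (φ : ℕ → ℕ) → IsΦ₃ φ →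
    (∀ a b → 𝒫-position (a ∷ b ∷ 3 ∷ []) ⇔ b ≡ φ a)
    × (∀ a b → 30 ≤ a → 30 ≤ b →
    𝒫-position (a ∷ b ∷ 3 ∷ []) ⇔
    + (a ⊕ b) ≡ + 2 ℤ.+ -1ℤ ℤ.^ (⌊log₂ᵘ (+ a / 7) ⌋ + 1))
theorem21 φ isφ =
  (λ a b → subst (λ z → _ ⇔ b ≡ z) (sym (IsΦ₃⇒≗Φ isφ a)) (𝒫⇔Φ ≤-refl a b)) ,
  (λ a b 30≤a _ → xor-form a b 30≤a ⇔-∘ 𝒫⇔Φ ≤-refl a b)
  where
  -- The integer quotient in the floor carries the sign of the denominator as a factor, here 1.
  log : ∀ a → ⌊log₂ᵘ (+ a / 7) ⌋ ≡ level a
  log a = cong (λ z → ⌊log₂ ℤ.∣ z ∣ ⌋) (ℤ.*-identityˡ (+ (a ℕ./ 7)))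

  sign : ∀ a → + 2 ℤ.+ -1ℤ ℤ.^ (⌊log₂ᵘ (+ a / 7) ⌋ + 1) ≡ + (3 ⊕ twist (level a))
  sign a = trans (cong (λ k → + 2 ℤ.+ -1ℤ ℤ.^ (k + 1)) (log a)) (2+[-1]^[1+n] (level a))

  xor-form : ∀ a b → 30 ≤ a →
    b ≡ Φ 3 a ⇔ + (a ⊕ b) ≡ + 2 ℤ.+ -1ℤ ℤ.^ (⌊log₂ᵘ (+ a / 7) ⌋ + 1)
  xor-form a b 30≤a = mk⇔
    (λ e → trans (cong +_ (trans (cong (a ⊕_) (trans e (Φ-regular 3 30≤a)))
                             (⊕-cancel a (3 ⊕ twist (level a)))))
                 (sym (sign a)))
    (λ e → trans (sym (⊕-cancel a b))
             (trans (cong (a ⊕_) (ℤ.+-injective (trans e (sign a))))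
                    (sym (Φ-regular 3 30≤a))))
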